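{- For all nonnegative integers $n_1,n_2$, \[ \zeta_2(-n_1,-n_2)+\zeta_2(-n_2,-n_1)+\zeta_1(-n_1-n_2)-\zeta_1(-n_1)\zeta_1(-n_2)=\frac{(-1)^{n_1+1}\,n_1!\,n_2!}{(n_1+n_2+2)!}\,B_{n_1+n_2+2}. \]
   Context: Bernoulli numbers $B_m$ are defined by $\frac{t}{e^t-1}=\sum_{m\ge0}B_m\frac{t^m}{m!}$. The multiple zeta values at negative integers are those of Sadaoui's analytic continuation of the Euler–Zagier multiple zeta function. In the paper's closed form, $\zeta_1(-n)=(-1)^n\frac{B_{n+1}}{n+1}$ and \[ \zeta_2(-n_1,-n_2)=\frac{(-1)^{n_1+n_2}}{n_2+1}\sum_{k=0}^{n_2+1}\binom{n_2+1}{k}\frac{B_{n_1+1+k}}{n_1+1+k}\,B_{n_2+1-k} \] for nonnegative integers $n,n_1,n_2$. -}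

module Defs where

open import Data.Nat as ℕ using (ℕ; zero; suc; _∸_)
open import Data.Nat.Combinatorics using (_C_)
open import Data.Integer as ℤ using (ℤ; +_)
open import Data.Rational as ℚ using (ℚ; _+_; _*_; -_; _/_; 0ℚ; 1ℚ)
open import Data.List using (List; []; _∷_; reverse; length)

sumTo : ℕ → (ℕ → ℚ) → ℚ
sumTo zero    f = 0ℚ
sumTo (suc n) f = sumTo n f + f n

sign : ℕ → ℚ
sign zero    = 1ℚ
sign (suc n) = - sign n

nat : ℕ → ℚ
nat n = (+ n) / 1

private
  idx : List ℚ → ℕ → ℚ
  idx []       _       = 0ℚ
  idx (x ∷ xs) zero    = x
  idx (x ∷ xs) (suc k) = idx xs k

  -- bernList m = [B_0, ..., B_m] built from the standard recurrence
  -- Σ_{k=0}^{m} C(m+1,k) B_k = 0 (m ≥ 1), B_0 = 1, which characterises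
  -- the Bernoulli numbers of t/(e^t-1) (so B_1 = -1/2).
  next : ℕ → List ℚ → ℚ
  next m bs = - ((+ 1 / suc m) * sumTo m (λ k → nat (suc m C k) * idx bs k))

  bernList : ℕ → List ℚ
  bernList zero    = 1ℚ ∷ []
  bernList (suc m) = let bs = bernList m in appendQ bs (next (suc m) bs)
    where
    appendQ : List ℚ → ℚ → List ℚ
    appendQ []       y = y ∷ []
    appendQ (x ∷ xs) y = x ∷ appendQ xs y

-- Bernoulli number B_m with t/(e^t-1) = Σ B_m t^m/m!
B : ℕ → ℚ
B m = idx (bernList m) m

-- ζ_1(-n) = (-1)^n B_{n+1}/(n+1)
ζ₁ : ℕ → ℚ
ζ₁ n = sign n * (B (suc n) * (+ 1 / suc n))

-- ζ_2(-n₁,-n₂) per the paper's closed form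
ζ₂ : ℕ → ℕ → ℚ
ζ₂ n₁ n₂ =
  sign (n₁ ℕ.+ n₂) * ((+ 1 / suc n₂) *
    sumTo (suc (suc n₂)) (λ k →
      nat (suc n₂ C k) * ((B (suc n₁ ℕ.+ k) * (+ 1 / suc (n₁ ℕ.+ k))) * B (suc n₂ ∸ k))))

{-# OPTIONS --safe #-}

-- Let f(s) = s/(e^s - 1).  Clearing denominators in e^(s+t) = e^s e^t gives
--   (s + t) f(s) f(t) = f(s + t) (s t + t f(s) + s f(t)).
-- With w(z) = (f(z) - 1)/z, whose coefficients are B_(n+1)/(n+1), the series
--   X(s,t) = f(s) f(t) - w(s + t) (s t + t f(s) + s f(t))
-- therefore satisfies (s + t) X = s t + t f(s) + s f(t).  The coefficient of X at
-- (n₁ + 1, n₂ + 1) is, up to sign and the factor (n₁ + 1)(n₂ + 1), the left-hand side of the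
-- theorem, and the equation for X is a first-order recurrence which determines it.
-- Series are exponential and given by their coefficient sequences; series in s and t are
-- series in s over the ring of series in t.
module Submission where

open import Defs
open import Algebra.Bundles using (CommutativeRing)
import Algebra.Construct.Pointwise as Pointwise
import Algebra.Properties.AbelianGroup as AbelianGroupProperties
import Algebra.Properties.CommutativeSemigroup as CommutativeSemigroupProperties
import Algebra.Properties.Monoid.Mult as Mult
import Algebra.Properties.Ring as RingProperties
import Algebra.Solver.Ring.NaturalCoefficients.Default as RingSolver
open import Data.Integer as ℤ using (+_)
import Data.Integer.Properties as ℤ
open import Data.List using (List; []; _∷_; length)
open import Data.Nat as ℕ using (ℕ; zero; suc; _∸_; _!; _<_; _≤_; s≤s)
import Data.Nat.Properties as ℕ
open import Data.Nat.Properties using (_!≢0)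
open import Data.Nat.Combinatorics using (_C_; nCn≡1; nC1≡n; nCk≡nC[n∸k]; nCk+nC[k+1]≡[n+1]C[k+1]; k>n⇒nCk≡0)
open import Data.Product using (_,_)
open import Data.Sum using (inj₁; inj₂)
open import Level using (_⊔_)
import Relation.Binary.Reasoning.Setoid as SetoidReasoning

-- Hurwitz series

module HurwitzSeries {c ℓ} (R : CommutativeRing c ℓ) where

  open CommutativeRing R hiding (zero)
  open CommutativeSemigroupProperties +-commutativeSemigroup using (interchange)
  open Mult +-monoid using (_×_)
  open SetoidReasoning setoid

  Series : Set c
  Series = ℕ → Carrier

  D : Series → Series
  D f n = f (suc n)

  infix  4 _≋_
  infixl 6 _⊕_
  infixl 7 _⊛_

  _≋_ : Series → Series → Set ℓ
  f ≋ g = ∀ n → f n ≈ g n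

  _⊕_ : Series → Series → Series
  (f ⊕ g) n = f n + g n

  -- The Leibniz rule as a definition: (f ⊛ g) n = Σₖ C(n,k) f k g (n ∸ k).
  _⊛_ : Series → Series → Series
  (f ⊛ g) zero    = f zero * g zero
  (f ⊛ g) (suc n) = (D f ⊛ g) n + (f ⊛ D g) n

  const : Carrier → Series
  const x zero    = x
  const x (suc n) = 0#

  var : Series
  var zero    = 0#
  var (suc n) = const 1# n

  ⊛-cong : ∀ {f f′ g g′} → f ≋ f′ → g ≋ g′ → f ⊛ g ≋ f′ ⊛ g′
  ⊛-cong p q zero    = *-cong (p zero) (q zero)
  ⊛-cong p q (suc n) = +-cong (⊛-cong (λ k → p (suc k)) q n) (⊛-cong p (λ k → q (suc k)) n)

  ⊛-comm : ∀ f g → f ⊛ g ≋ g ⊛ f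
  ⊛-comm f g zero    = *-comm (f zero) (g zero)
  ⊛-comm f g (suc n) = trans (+-comm _ _) (+-cong (⊛-comm f (D g) n) (⊛-comm (D f) g n))

  ⊛-distribʳ : ∀ f g h → (g ⊕ h) ⊛ f ≋ (g ⊛ f) ⊕ (h ⊛ f)
  ⊛-distribʳ f g h zero    = distribʳ (f zero) (g zero) (h zero)
  ⊛-distribʳ f g h (suc n) =
    trans (+-cong (⊛-distribʳ f (D g) (D h) n) (⊛-distribʳ (D f) g h n)) (interchange _ _ _ _)

  ⊛-distribˡ : ∀ f g h → f ⊛ (g ⊕ h) ≋ (f ⊛ g) ⊕ (f ⊛ h)
  ⊛-distribˡ f g h n = begin
    (f ⊛ (g ⊕ h)) n          ≈⟨ ⊛-comm f (g ⊕ h) n ⟩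
    ((g ⊕ h) ⊛ f) n          ≈⟨ ⊛-distribʳ f g h n ⟩
    (g ⊛ f) n + (h ⊛ f) n    ≈⟨ +-cong (⊛-comm g f n) (⊛-comm h f n) ⟩
    (f ⊛ g) n + (f ⊛ h) n    ∎

  -- `D` is a derivation, so on either bracketing it yields the same three terms, with `D` on one
  -- factor each. Induction on the coefficient index, for all series at once, needs no binomial
  -- identity.
  ⊛-assoc : ∀ f g h → (f ⊛ g) ⊛ h ≋ f ⊛ (g ⊛ h)
  ⊛-assoc f g h zero    = *-assoc (f zero) (g zero) (h zero)
  ⊛-assoc f g h (suc n) = begin
    (((D f ⊛ g) ⊕ (f ⊛ D g)) ⊛ h) n + ((f ⊛ g) ⊛ D h) n
      ≈⟨ +-congʳ (⊛-distribʳ h (D f ⊛ g) (f ⊛ D g) n) ⟩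
    ((D f ⊛ g) ⊛ h) n + ((f ⊛ D g) ⊛ h) n + ((f ⊛ g) ⊛ D h) n
      ≈⟨ +-cong (+-cong (⊛-assoc (D f) g h n) (⊛-assoc f (D g) h n)) (⊛-assoc f g (D h) n) ⟩
    (D f ⊛ (g ⊛ h)) n + (f ⊛ (D g ⊛ h)) n + (f ⊛ (g ⊛ D h)) n
      ≈⟨ +-assoc _ _ _ ⟩
    (D f ⊛ (g ⊛ h)) n + ((f ⊛ (D g ⊛ h)) n + (f ⊛ (g ⊛ D h)) n)
      ≈⟨ +-congˡ (⊛-distribˡ f (D g ⊛ h) (g ⊛ D h) n) ⟨
    (D f ⊛ (g ⊛ h)) n + (f ⊛ ((D g ⊛ h) ⊕ (g ⊛ D h))) n ∎

  zero-⊛ : ∀ g n → ((λ _ → 0#) ⊛ g) n ≈ 0#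
  zero-⊛ g zero    = zeroˡ (g zero)
  zero-⊛ g (suc n) = trans (+-cong (zero-⊛ g n) (zero-⊛ (D g) n)) (+-identityˡ 0#)

  const-⊛ : ∀ x g n → (const x ⊛ g) n ≈ x * g n
  const-⊛ x g zero    = refl
  const-⊛ x g (suc n) = trans (+-cong (zero-⊛ g n) (const-⊛ x (D g) n)) (+-identityˡ _)

  ⊛-const : ∀ g x n → (g ⊛ const x) n ≈ g n * x
  ⊛-const g x n = trans (⊛-comm g (const x) n) (trans (const-⊛ x g n) (*-comm x (g n)))

  ⊛-identityˡ : ∀ g → const 1# ⊛ g ≋ g
  ⊛-identityˡ g n = trans (const-⊛ 1# g n) (*-identityˡ (g n))

  -- Since `D var` is `const 1#`, each application of the Leibniz rule splits off one more copy of
  -- `g n`. In exponential normalisation, multiplication by the variable thus shifts the index and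
  -- introduces the factor `suc n`.
  var-⊛ : ∀ g n → (var ⊛ g) (suc n) ≈ suc n × g n
  var-⊛ g n = +-cong (⊛-identityˡ g n) (rest n)
    where
    rest : ∀ n → (var ⊛ D g) n ≈ n × g n
    rest zero    = zeroˡ (g 1)
    rest (suc m) = var-⊛ (D g) m

  seriesRing : CommutativeRing c ℓ
  seriesRing = record
    { Carrier = Series
    ; _≈_ = _≋_
    ; _+_ = _⊕_
    ; _*_ = _⊛_
    ; -_  = λ f n → - f n
    ; 0#  = λ _ → 0#
    ; 1#  = const 1#
    ; isCommutativeRing = record
      { isRing = record
        { +-isAbelianGroup = Pointwise.isAbelianGroup ℕ +-isAbelianGroup
        ; *-cong = ⊛-cong
        ; *-assoc = ⊛-assoc
        ; *-identity = ⊛-identityˡ , λ g n → trans (⊛-comm g (const 1#) n) (⊛-identityˡ g n)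
        ; distrib = ⊛-distribˡ , ⊛-distribʳ
        }
      ; *-comm = ⊛-comm
      }
    }

-- Homomorphisms of rings and of their series rings

module _ {c₁ ℓ₁ c₂ ℓ₂} (R : CommutativeRing c₁ ℓ₁) (S : CommutativeRing c₂ ℓ₂) where

  private
    module R = CommutativeRing R
    module S = CommutativeRing S

  record IsHomomorphism (ι : R.Carrier → S.Carrier) : Set (c₁ ⊔ ℓ₁ ⊔ c₂ ⊔ ℓ₂) where
    field
      cong   : ∀ {x y} → x R.≈ y → ι x S.≈ ι y
      +-homo : ∀ x y → ι (x R.+ y) S.≈ ι x S.+ ι y
      *-homo : ∀ x y → ι (x R.* y) S.≈ ι x S.* ι y
      0-homo : ι R.0# S.≈ S.0#
      1-homo : ι R.1# S.≈ S.1#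

    inverse : ∀ {x y} → x R.* y R.≈ R.1# → ι x S.* ι y S.≈ S.1#
    inverse {x} {y} eq = S.trans (S.sym (*-homo x y)) (S.trans (cong eq) 1-homo)

    -- Both z (e^z - 1)/z + 1 = e^z and z w(z) + 1 = f(z) have this shape; they are carried along
    -- substitutions of s, t and s + t for z.
    affine : ∀ {x y z} → x R.* y R.+ R.1# R.≈ z → ι x S.* ι y S.+ S.1# S.≈ ι z
    affine {x} {y} {z} eq = begin
      ι x S.* ι y S.+ S.1#     ≈⟨ S.+-cong (*-homo x y) 1-homo ⟨
      ι (x R.* y) S.+ ι R.1#   ≈⟨ +-homo (x R.* y) R.1# ⟨
      ι (x R.* y R.+ R.1#)     ≈⟨ cong eq ⟩
      ι z                      ∎
      where open SetoidReasoning S.setoid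

const-homo : ∀ {c ℓ} (R : CommutativeRing c ℓ) →
  IsHomomorphism R (HurwitzSeries.seriesRing R) (HurwitzSeries.const R)
const-homo R = record
  { cong   = λ { eq zero → eq ; eq (suc n) → R.refl }
  ; +-homo = λ { x y zero → R.refl ; x y (suc n) → R.sym (R.+-identityˡ R.0#) }
  ; *-homo = λ
      { x y zero    → R.refl
      ; x y (suc n) → R.sym (R.trans (H.const-⊛ x (H.const y) (suc n)) (R.zeroʳ x)) }
  ; 0-homo = λ { zero → R.refl ; (suc n) → R.refl }
  ; 1-homo = λ n → R.refl
  }
  where
  module R = CommutativeRing R
  module H = HurwitzSeries R

module _ {c₁ ℓ₁ c₂ ℓ₂} {R : CommutativeRing c₁ ℓ₁} {S : CommutativeRing c₂ ℓ₂}
  {ι : CommutativeRing.Carrier R → CommutativeRing.Carrier S} (ι-homo : IsHomomorphism R S ι) where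

  private
    module S = CommutativeRing S
    module HR = HurwitzSeries R
    module HS = HurwitzSeries S
    module ι = IsHomomorphism ι-homo

  map-homo : IsHomomorphism HR.seriesRing HS.seriesRing (λ f n → ι (f n))
  map-homo = record
    { cong   = λ eq n → ι.cong (eq n)
    ; +-homo = λ f g n → ι.+-homo (f n) (g n)
    ; *-homo = ⊛-homo
    ; 0-homo = λ n → ι.0-homo
    ; 1-homo = λ { zero → ι.1-homo ; (suc n) → ι.0-homo }
    }
    where
    ⊛-homo : ∀ f g n → ι ((f HR.⊛ g) n) S.≈ ((λ k → ι (f k)) HS.⊛ (λ k → ι (g k))) n
    ⊛-homo f g zero    = ι.*-homo (f zero) (g zero)
    ⊛-homo f g (suc n) =
      S.trans (ι.+-homo _ _) (S.+-cong (⊛-homo (HR.D f) g n) (⊛-homo f (HR.D g) n))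

-- Series in two variables

module BivariateSeries {c ℓ} (R : CommutativeRing c ℓ) where

  open CommutativeRing R hiding (zero)
  open Mult +-monoid using (_×_)
  open HurwitzSeries R

  private
    module S = CommutativeRing seriesRing
    module H² = HurwitzSeries seriesRing
    module ×ₛ = Mult S.+-monoid
    module T = CommutativeRing H².seriesRing

  open H² public using () renaming (_⊛_ to _⊛²_; _⊕_ to _⊕²_; seriesRing to bivariateRing)

  s t : T.Carrier
  s = H².var
  t = H².const var

  -- These are f(s), f(t) and f(s + t). By the binomial theorem, (s + t)^n / n! is the sum of s^a
  -- t^b / (a! b!) over a + b = n, so the exponential coefficient of f(s + t) at (a, b) is simply
  -- `f (a ℕ.+ b)`.
  inS inT inSum : Series → T.Carrier
  inS   f a   = const (f a)
  inT   f     = H².const f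
  inSum f a b = f (a ℕ.+ b)

  inS-homo : IsHomomorphism seriesRing bivariateRing inS
  inS-homo = map-homo (const-homo R)

  inT-homo : IsHomomorphism seriesRing bivariateRing inT
  inT-homo = const-homo seriesRing

  inSum-homo : IsHomomorphism seriesRing bivariateRing inSum
  inSum-homo = record
    { cong   = λ eq a b → eq (a ℕ.+ b)
    ; +-homo = λ f g a b → refl
    ; *-homo = ⊛-homo
    ; 0-homo = λ a b → refl
    ; 1-homo = λ { zero b → refl ; (suc a) b → refl }
    }
    where
    ⊛-homo : ∀ f g a b → (f ⊛ g) (a ℕ.+ b) ≈ (inSum f ⊛² inSum g) a b
    -- At s = 0 both sides are `(f ⊛ g) b`; the next clause is the Leibniz rule in s, because
    -- differentiating `inSum f` by s gives `inSum (D f)`.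
    ⊛-homo f g zero    b = refl
    ⊛-homo f g (suc a) b = +-cong (⊛-homo (D f) g a b) (⊛-homo f (D g) a b)

  inS-var : inS var T.≈ s
  inS-var zero          zero    = refl
  inS-var zero          (suc b) = refl
  inS-var (suc zero)    b       = refl
  inS-var (suc (suc a)) zero    = refl
  inS-var (suc (suc a)) (suc b) = refl

  inSum-var : inSum var T.≈ s ⊕² t
  inSum-var zero          b       = sym (+-identityˡ (var b))
  inSum-var (suc zero)    b       = sym (+-identityʳ (const 1# b))
  inSum-var (suc (suc a)) b       = sym (+-identityˡ 0#)

  inS-⊛-inT : ∀ f g a b → (inS f ⊛² inT g) a b ≈ f a * g b
  inS-⊛-inT f g a b = trans (H².⊛-const (inS f) g a b) (const-⊛ (f a) g b)

  ⊛-inT : ∀ G f a b → (G ⊛² inT f) a b ≈ (G a ⊛ f) b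
  ⊛-inT G f a b = H².⊛-const G f a b

  ⊛-inS : ∀ G f a b → (G ⊛² inS f) a b ≈ ((λ k → G k b) ⊛ f) a
  ⊛-inS G f zero    b = ⊛-const (G zero) (f zero) b
  ⊛-inS G f (suc a) b = +-cong (⊛-inS (H².D G) f a b) (⊛-inS G (D f) a b)

  ×-pointwise : ∀ n f k → (n ×ₛ.× f) k ≈ n × f k
  ×-pointwise zero    f k = refl
  ×-pointwise (suc n) f k = +-congˡ (×-pointwise n f k)

  s-⊛ : ∀ G a b → (s ⊛² G) (suc a) b ≈ suc a × G a b
  s-⊛ G a b = trans (H².var-⊛ G a b) (×-pointwise (suc a) (G a) b)

  t-⊛-zero : ∀ G a → (t ⊛² G) a 0 ≈ 0#
  t-⊛-zero G a = trans (H².const-⊛ var G a 0) (zeroˡ (G a 0))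

  t-⊛ : ∀ G a b → (t ⊛² G) a (suc b) ≈ suc b × G a b
  t-⊛ G a b = trans (H².const-⊛ var G a (suc b)) (var-⊛ (G a) b)

-- Identities in commutative rings

module _ {c ℓ} (R : CommutativeRing c ℓ) where

  open CommutativeRing R hiding (zero)
  open AbelianGroupProperties +-abelianGroup using (∙-cancelˡ; xyx⁻¹≈y; ⁻¹-∙-comm)
  open RingProperties ring using (-‿distribˡ-*)
  open RingSolver commutativeSemiring using (solve; _:+_; _:*_; _:=_; con)
  open SetoidReasoning setoid

  cancel-invertible : ∀ {x x⁻¹ y z} → x * x⁻¹ ≈ 1# → x * y ≈ x * z → y ≈ z
  cancel-invertible {x} {x⁻¹} {y} {z} inv eq = begin
    y               ≈⟨ undo y ⟨
    x⁻¹ * (x * y)   ≈⟨ *-congˡ eq ⟩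
    x⁻¹ * (x * z)   ≈⟨ undo z ⟩
    z               ∎
    where
    undo : ∀ y → x⁻¹ * (x * y) ≈ y
    undo y = begin
      x⁻¹ * (x * y)   ≈⟨ solve 3 (λ x x⁻¹ y → x⁻¹ :* (x :* y) := x :* x⁻¹ :* y) refl x x⁻¹ y ⟩
      x * x⁻¹ * y     ≈⟨ *-congʳ inv ⟩
      1# * y          ≈⟨ *-identityˡ y ⟩
      y               ∎

  -- Expanding `f * (v * h + 1#)` and cancelling `f` suffices. The factor `v` stays on both sides,
  -- because it will be the variable, which is not invertible among series.
  cofactor : ∀ {f h v e} → v * h + 1# ≈ e → f * e ≈ f + v → v * (f * h) ≈ v
  cofactor {f} {h} {v} {e} e-eq f-eq = ∙-cancelˡ f _ _ (begin
    f + v * (f * h)    ≈⟨ solve 3 (λ f h v → f :+ v :* (f :* h) := f :* (v :* h :+ con 1)) refl f h v ⟩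
    f * (v * h + 1#)   ≈⟨ *-congˡ e-eq ⟩
    f * e              ≈⟨ f-eq ⟩
    f + v              ∎)

  -‿step : ∀ m n σ x y → - (m * (σ * (n * x * y))) ≈ n * (- σ * (m * x * y))
  -‿step m n σ x y = begin
    - (m * (σ * (n * x * y)))   ≈⟨ -‿cong (solve 5 (λ m n σ x y →
                                     m :* (σ :* (n :* x :* y)) := σ :* (n :* (m :* x :* y))) refl m n σ x y) ⟩
    - (σ * (n * (m * x * y)))   ≈⟨ -‿distribˡ-* σ _ ⟩
    - σ * (n * (m * x * y))     ≈⟨ solve 5 (λ m n σ x y →
                                     σ :* (n :* (m :* x :* y)) := n :* (σ :* (m :* x :* y))) refl m n (- σ) x y ⟩
    n * (- σ * (m * x * y))     ∎

  divide-through : ∀ {m m⁻¹ n n⁻¹ d w x y u v} → m * m⁻¹ ≈ 1# → n * n⁻¹ ≈ 1# →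
    d + (m * (n * w) + n * x + m * y) ≈ u * v →
    m⁻¹ * n⁻¹ * d + (w + m⁻¹ * x + n⁻¹ * y) ≈ u * m⁻¹ * (v * n⁻¹)
  divide-through {m} {m⁻¹} {n} {n⁻¹} {d} {w} {x} {y} {u} {v} m-inv n-inv eq = begin
    m⁻¹ * n⁻¹ * d + (w + m⁻¹ * x + n⁻¹ * y)
      ≈⟨ +-congˡ (+-cong (+-cong
           (trans (*-congʳ (*-cong m-inv n-inv)) (trans (*-congʳ (*-identityˡ 1#)) (*-identityˡ w)))
           (trans (*-congʳ n-inv) (*-identityˡ (m⁻¹ * x))))
           (trans (*-congʳ m-inv) (*-identityˡ (n⁻¹ * y)))) ⟨
    m⁻¹ * n⁻¹ * d + (m * m⁻¹ * (n * n⁻¹) * w + n * n⁻¹ * (m⁻¹ * x) + m * m⁻¹ * (n⁻¹ * y))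
      ≈⟨ solve 8 (λ m m⁻¹ n n⁻¹ d w x y →
           m⁻¹ :* n⁻¹ :* d :+ (m :* m⁻¹ :* (n :* n⁻¹) :* w :+ n :* n⁻¹ :* (m⁻¹ :* x) :+ m :* m⁻¹ :* (n⁻¹ :* y)) :=
           m⁻¹ :* n⁻¹ :* (d :+ (m :* (n :* w) :+ n :* x :+ m :* y)))
           refl m m⁻¹ n n⁻¹ d w x y ⟩
    m⁻¹ * n⁻¹ * (d + (m * (n * w) + n * x + m * y))
      ≈⟨ *-congˡ eq ⟩
    m⁻¹ * n⁻¹ * (u * v)
      ≈⟨ solve 4 (λ m⁻¹ n⁻¹ u v → m⁻¹ :* n⁻¹ :* (u :* v) := u :* m⁻¹ :* (v :* n⁻¹)) refl m⁻¹ n⁻¹ u v ⟩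
    u * m⁻¹ * (v * n⁻¹) ∎

  cancel-inverses : ∀ {m m⁻¹ n n⁻¹} σ x y → m * m⁻¹ ≈ 1# → n * n⁻¹ ≈ 1# →
    m⁻¹ * n⁻¹ * (σ * (m * n * x * y)) ≈ σ * (x * y)
  cancel-inverses {m} {m⁻¹} {n} {n⁻¹} σ x y m-inv n-inv = begin
    m⁻¹ * n⁻¹ * (σ * (m * n * x * y))
      ≈⟨ solve 7 (λ m m⁻¹ n n⁻¹ σ x y →
           m⁻¹ :* n⁻¹ :* (σ :* (m :* n :* x :* y)) := m :* m⁻¹ :* (n :* n⁻¹ :* (σ :* (x :* y))))
           refl m m⁻¹ n n⁻¹ σ x y ⟩
    m * m⁻¹ * (n * n⁻¹ * (σ * (x * y)))
      ≈⟨ *-cong m-inv (*-congʳ n-inv) ⟩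
    1# * (1# * (σ * (x * y)))
      ≈⟨ trans (*-identityˡ _) (*-identityˡ _) ⟩
    σ * (x * y) ∎

  -- Multiplied by `σ * τ`, the second hypothesis expresses `σ * u * (τ * v)` as `σ * x + q`,
  -- because `τ * τ` is 1. Subtracting this from `q` leaves `- σ * x`.
  signed-defect : ∀ {σ τ x y z w u v} → τ * τ ≈ 1# →
    τ * x + (w + z + y) ≈ u * v →
    σ * τ * y + σ * τ * z + σ * τ * w - σ * u * (τ * v) ≈ - σ * x
  signed-defect {σ} {τ} {x} {y} {z} {w} {u} {v} τ²≈1 eq = begin
    σ * τ * y + σ * τ * z + σ * τ * w - σ * u * (τ * v)
      ≈⟨ +-cong
           (solve 5 (λ σ τ y z w → σ :* τ :* y :+ σ :* τ :* z :+ σ :* τ :* w := σ :* τ :* (w :+ z :+ y))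
             refl σ τ y z w)
           (-‿cong product) ⟩
    q - (σ * x + q)
      ≈⟨ +-congˡ (⁻¹-∙-comm (σ * x) q) ⟨
    q + (- (σ * x) - q)
      ≈⟨ trans (sym (+-assoc _ _ _)) (xyx⁻¹≈y q (- (σ * x))) ⟩
    - (σ * x)
      ≈⟨ -‿distribˡ-* σ x ⟩
    - σ * x ∎
    where
    q = σ * τ * (w + z + y)

    product : σ * u * (τ * v) ≈ σ * x + q
    product = begin
      σ * u * (τ * v)
        ≈⟨ solve 4 (λ σ τ u v → σ :* u :* (τ :* v) := σ :* τ :* (u :* v)) refl σ τ u v ⟩
      σ * τ * (u * v)
        ≈⟨ *-congˡ eq ⟨
      σ * τ * (τ * x + (w + z + y))
        ≈⟨ solve 4 (λ σ τ x r → σ :* τ :* (τ :* x :+ r) := τ :* τ :* (σ :* x) :+ σ :* τ :* r)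
             refl σ τ x (w + z + y) ⟩
      τ * τ * (σ * x) + q
        ≈⟨ +-congʳ (trans (*-congʳ τ²≈1) (*-identityˡ (σ * x))) ⟩
      σ * x + q ∎

  module _ {s t f g h f⁻¹ g⁻¹ h⁻¹ : Carrier}
    (f-inv : f * f⁻¹ ≈ 1#) (g-inv : g * g⁻¹ ≈ 1#) (h-inv : h * h⁻¹ ≈ 1#)
    (exp-+ : (s + t) * h⁻¹ + 1# ≈ (s * f⁻¹ + 1#) * (t * g⁻¹ + 1#)) where

    -- With `f`, `g`, `h` for f(s), f(t), f(s + t), the factor `s * f⁻¹ + 1#` is e^s and `exp-+`
    -- says e^(s+t) = e^s e^t. Removing 1 from both sides and multiplying by `f * g * h` cancels
    -- every inverse.
    addition-formula : (s + t) * (f * g) ≈ h * (s * t + t * f + s * g)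
    addition-formula = begin
      (s + t) * (f * g)
        ≈⟨ *-identityʳ _ ⟨
      (s + t) * (f * g) * 1#
        ≈⟨ *-congˡ h-inv ⟨
      (s + t) * (f * g) * (h * h⁻¹)
        ≈⟨ solve 5 (λ u f g h h⁻¹ → u :* (f :* g) :* (h :* h⁻¹) := f :* g :* h :* (u :* h⁻¹)) refl
             (s + t) f g h h⁻¹ ⟩
      f * g * h * ((s + t) * h⁻¹)
        ≈⟨ *-congˡ exp-+′ ⟩
      f * g * h * (s * f⁻¹ + t * g⁻¹ + s * f⁻¹ * (t * g⁻¹))
        ≈⟨ solve 7 (λ s t f g h f⁻¹ g⁻¹ →
             f :* g :* h :* (s :* f⁻¹ :+ t :* g⁻¹ :+ s :* f⁻¹ :* (t :* g⁻¹)) :=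
             h :* (s :* t :* (f :* f⁻¹) :* (g :* g⁻¹) :+ t :* f :* (g :* g⁻¹) :+ s :* g :* (f :* f⁻¹)))
             refl s t f g h f⁻¹ g⁻¹ ⟩
      h * (s * t * (f * f⁻¹) * (g * g⁻¹) + t * f * (g * g⁻¹) + s * g * (f * f⁻¹))
        ≈⟨ *-congˡ (+-cong (+-cong (*-cong (*-congˡ f-inv) g-inv) (*-congˡ g-inv)) (*-congˡ f-inv)) ⟩
      h * (s * t * 1# * 1# + t * f * 1# + s * g * 1#)
        ≈⟨ *-congˡ (+-cong (+-cong (trans (*-identityʳ _) (*-identityʳ _)) (*-identityʳ _)) (*-identityʳ _)) ⟩
      h * (s * t + t * f + s * g) ∎
      where
      exp-+′ : (s + t) * h⁻¹ ≈ s * f⁻¹ + t * g⁻¹ + s * f⁻¹ * (t * g⁻¹)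
      exp-+′ = ∙-cancelˡ 1# _ _ (begin
        1# + (s + t) * h⁻¹
          ≈⟨ +-comm _ _ ⟩
        (s + t) * h⁻¹ + 1#
          ≈⟨ exp-+ ⟩
        (s * f⁻¹ + 1#) * (t * g⁻¹ + 1#)
          ≈⟨ solve 2 (λ x y → (x :+ con 1) :* (y :+ con 1) := con 1 :+ (x :+ y :+ x :* y)) refl
               (s * f⁻¹) (t * g⁻¹) ⟩
        1# + (s * f⁻¹ + t * g⁻¹ + s * f⁻¹ * (t * g⁻¹)) ∎)

    -- By the second hypothesis `x` is `f * g - w * q`. Multiplied by `s + t`, the first term
    -- becomes `h * q` by the addition formula and the second `(h - 1) * q`, which leaves `q`.
    -- Neither `s + t` nor `q` has to be inverted.
    defect-formula : ∀ {w x} → (s + t) * w + 1# ≈ h →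
      x + (s * (t * w) + t * (w * f) + s * (w * g)) ≈ f * g →
      (s + t) * x ≈ s * t + t * f + s * g
    defect-formula {w} {x} w-eq x-eq = ∙-cancelˡ ((s + t) * w * q) _ _ (begin
      (s + t) * w * q + (s + t) * x
        ≈⟨ solve 6 (λ s t f g w x →
             (s :+ t) :* w :* (s :* t :+ t :* f :+ s :* g) :+ (s :+ t) :* x :=
             (s :+ t) :* (x :+ (s :* (t :* w) :+ t :* (w :* f) :+ s :* (w :* g))))
             refl s t f g w x ⟩
      (s + t) * (x + (s * (t * w) + t * (w * f) + s * (w * g)))
        ≈⟨ *-congˡ x-eq ⟩
      (s + t) * (f * g)
        ≈⟨ addition-formula ⟩
      h * q
        ≈⟨ *-congʳ w-eq ⟨
      ((s + t) * w + 1#) * q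
        ≈⟨ distribʳ q _ _ ⟩
      (s + t) * w * q + 1# * q
        ≈⟨ +-congˡ (*-identityˡ q) ⟩
      (s + t) * w * q + q ∎)
      where
      q = s * t + t * f + s * g

-- The defect series and its recurrence

module AdditionFormula {c ℓ} (R : CommutativeRing c ℓ) where

  open CommutativeRing R hiding (zero)
  open Mult +-monoid using (_×_; ×-congʳ; ×-idem)
  open HurwitzSeries R
  open BivariateSeries R

  private
    module T = CommutativeRing bivariateRing
    module S = IsHomomorphism inS-homo
    module T′ = IsHomomorphism inT-homo
    module Sum = IsHomomorphism inSum-homo

  ×-zero : ∀ n → suc n × 0# ≈ 0#
  ×-zero n = ×-idem (+-identityˡ 0#) (suc n)

  -- The intended series are z/(e^z - 1) for `f`, its inverse (e^z - 1)/z for `h`, and (f(z) - 1)/z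
  -- for `w`. The constant sequence `1#` is e^z, whose exponential coefficients are all 1.
  module Defect (f h w : Series)
    (f⊛h : f ⊛ h ≋ const 1#)
    (var⊛h : (var ⊛ h) ⊕ const 1# ≋ (λ _ → 1#))
    (var⊛w : (var ⊛ w) ⊕ const 1# ≋ f) where

    -- This is w(s + t) (s t + t f(s) + s f(t)), expanded with the variables outermost so that `s-⊛`
    -- and `t-⊛` read off the coefficients.
    correction : T.Carrier
    correction = (s ⊛² (t ⊛² inSum w)) ⊕² (t ⊛² (inSum w ⊛² inS f)) ⊕² (s ⊛² (inSum w ⊛² inT f))

    defect : T.Carrier
    defect = (inS f ⊛² inT f) T.- correction

    defect⊕correction : defect ⊕² correction T.≈ inS f ⊛² inT f
    defect⊕correction a b = trans (+-assoc _ _ _) (trans (+-congˡ (-‿inverseˡ _)) (+-identityʳ _))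

    defect-equation : (s ⊕² t) ⊛² defect T.≈ (s ⊛² t) ⊕² (t ⊛² inS f) ⊕² (s ⊛² inT f)
    defect-equation = defect-formula bivariateRing
      {h = inSum f} {f⁻¹ = inS h} {g⁻¹ = inT h} {h⁻¹ = inSum h}
      (S.inverse f⊛h) (T′.inverse f⊛h) (Sum.inverse f⊛h)
      (begin
        (s ⊕² t) ⊛² inSum h ⊕² T.1#
          ≈⟨ T.+-congʳ (T.*-congʳ inSum-var) ⟨
        inSum var ⊛² inSum h ⊕² T.1#
          ≈⟨ Sum.affine var⊛h ⟩
        inSum (λ _ → 1#)
          -- The functional equation of the exponential: at every index, e^(s+t) has coefficient 1
          -- and e^s e^t has 1 times 1.
          ≈⟨ (λ a b → trans (inS-⊛-inT (λ _ → 1#) (λ _ → 1#) a b) (*-identityˡ 1#)) ⟨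
        inS (λ _ → 1#) ⊛² inT (λ _ → 1#)
          ≈⟨ T.*-cong (S.affine var⊛h) (T′.affine var⊛h) ⟨
        (inS var ⊛² inS h ⊕² T.1#) ⊛² (t ⊛² inT h ⊕² T.1#)
          ≈⟨ T.*-congʳ (T.+-congʳ (T.*-congʳ inS-var)) ⟩
        (s ⊛² inS h ⊕² T.1#) ⊛² (t ⊛² inT h ⊕² T.1#) ∎)
      (T.trans (T.+-congʳ (T.*-congʳ (T.sym inSum-var))) (Sum.affine var⊛w))
      defect⊕correction
      where open SetoidReasoning T.setoid

    open SetoidReasoning setoid

    defect-coefficient : ∀ a b →
      defect (suc a) (suc b) +
        (suc a × (suc b × w (a ℕ.+ b))
          + suc b × ((λ k → w (k ℕ.+ b)) ⊛ f) (suc a)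
          + suc a × ((λ k → w (a ℕ.+ k)) ⊛ f) (suc b))
      ≈ f (suc a) * f (suc b)
    defect-coefficient a b = begin
      _ ≈⟨ +-congˡ (+-cong (+-cong
             (trans (s-⊛ _ a (suc b)) (×-congʳ (suc a) (t-⊛ _ a b)))
             (trans (t-⊛ _ (suc a) b) (×-congʳ (suc b) (⊛-inS (inSum w) f (suc a) b))))
             (trans (s-⊛ _ a (suc b)) (×-congʳ (suc a) (⊛-inT (inSum w) f a (suc b))))) ⟨
      (defect ⊕² correction) (suc a) (suc b)   ≈⟨ defect⊕correction (suc a) (suc b) ⟩
      (inS f ⊛² inT f) (suc a) (suc b)    ≈⟨ inS-⊛-inT f f (suc a) (suc b) ⟩
      f (suc a) * f (suc b)               ∎

    -- Compare coefficients at (a + 2, 0) in `defect-equation`: s t and s f(t) are linear in s, and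
    -- every multiple of t vanishes at t-degree 0.
    defect-edge : ∀ a → suc (suc a) × defect (suc a) 0 ≈ 0#
    defect-edge a = begin
      suc (suc a) × defect (suc a) 0
        ≈⟨ +-identityʳ _ ⟨
      suc (suc a) × defect (suc a) 0 + 0#
        ≈⟨ +-cong (s-⊛ defect (suc a) 0) (t-⊛-zero defect (suc (suc a))) ⟨
      (s ⊛² defect) (suc (suc a)) 0 + (t ⊛² defect) (suc (suc a)) 0
        ≈⟨ T.distribʳ defect s t (suc (suc a)) 0 ⟨
      ((s ⊕² t) ⊛² defect) (suc (suc a)) 0
        ≈⟨ defect-equation (suc (suc a)) 0 ⟩
      (s ⊛² t) (suc (suc a)) 0 + (t ⊛² inS f) (suc (suc a)) 0 + (s ⊛² inT f) (suc (suc a)) 0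
        ≈⟨ +-cong (+-cong (trans (s-⊛ t (suc a) 0) (×-zero (suc a))) (t-⊛-zero (inS f) (suc (suc a))))
                  (trans (s-⊛ (inT f) (suc a) 0) (×-zero (suc a))) ⟩
      0# + 0# + 0#
        ≈⟨ trans (+-identityʳ _) (+-identityʳ _) ⟩
      0# ∎

    -- This compares coefficients at (a + 2, b + 1). Only t f(s) survives on the right, and it is
    -- linear in t: `const` keeps the value for b = 0 and gives 0 for larger b.
    defect-recurrence : ∀ a b →
      suc (suc a) × defect (suc a) (suc b) + suc b × defect (suc (suc a)) b
        ≈ suc b × const (f (suc (suc a))) b
    defect-recurrence a b = begin
      suc (suc a) × defect (suc a) (suc b) + suc b × defect (suc (suc a)) b
        ≈⟨ +-cong (s-⊛ defect (suc a) (suc b)) (t-⊛ defect (suc (suc a)) b) ⟨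
      (s ⊛² defect) (suc (suc a)) (suc b) + (t ⊛² defect) (suc (suc a)) (suc b)
        ≈⟨ T.distribʳ defect s t (suc (suc a)) (suc b) ⟨
      ((s ⊕² t) ⊛² defect) (suc (suc a)) (suc b)
        ≈⟨ defect-equation (suc (suc a)) (suc b) ⟩
      (s ⊛² t) (suc (suc a)) (suc b) + (t ⊛² inS f) (suc (suc a)) (suc b)
        + (s ⊛² inT f) (suc (suc a)) (suc b)
        ≈⟨ +-cong (+-cong (trans (s-⊛ t (suc a) (suc b)) (×-zero (suc a))) (t-⊛ (inS f) (suc (suc a)) b))
                  (trans (s-⊛ (inT f) (suc a) (suc b)) (×-zero (suc a))) ⟩
      0# + suc b × const (f (suc (suc a))) b + 0#
        ≈⟨ trans (+-identityʳ _) (+-identityˡ _) ⟩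
      suc b × const (f (suc (suc a))) b ∎

-- Rational numbers and binomial sums

open import Data.Rational using (ℚ; _+_; _-_; _*_; -_; _/_; 0ℚ; 1ℚ; fromℚᵘ; toℚᵘ)
open import Data.Rational.Properties
  using (+-*-commutativeRing; +-assoc; +-comm; +-identityˡ; +-identityʳ; +-inverseʳ; *-assoc; *-comm
        ; *-identityˡ; *-identityʳ; *-zeroˡ; *-zeroʳ; *-distribʳ-+; neg-distribˡ-*; neg-distribʳ-*
        ; toℚᵘ-injective; toℚᵘ-fromℚᵘ; fromℚᵘ-cong; toℚᵘ-homo-+; toℚᵘ-homo-*)
open import Data.Rational.Unnormalised as ℚᵘ using (mkℚᵘ; *≡*)
import Data.Rational.Unnormalised.Properties as ℚᵘ
open import Relation.Binary.PropositionalEquality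
  using (_≡_; refl; sym; trans; cong; cong₂; subst; module ≡-Reasoning)
open ≡-Reasoning

-- Rationals are stored in lowest terms, so fractions with variable entries do not add by
-- computation. Unnormalised fractions do, and their equality is cross-multiplication; `fromℚᵘ`
-- transfers such identities.
fromℚᵘ-homo-+ : ∀ p q → fromℚᵘ (p ℚᵘ.+ q) ≡ fromℚᵘ p + fromℚᵘ q
fromℚᵘ-homo-+ p q = toℚᵘ-injective (R.begin
  toℚᵘ (fromℚᵘ (p ℚᵘ.+ q))                R.≈⟨ toℚᵘ-fromℚᵘ (p ℚᵘ.+ q) ⟩
  p ℚᵘ.+ q                                R.≈⟨ ℚᵘ.+-cong (toℚᵘ-fromℚᵘ p) (toℚᵘ-fromℚᵘ q) ⟨
  toℚᵘ (fromℚᵘ p) ℚᵘ.+ toℚᵘ (fromℚᵘ q)    R.≈⟨ toℚᵘ-homo-+ (fromℚᵘ p) (fromℚᵘ q) ⟨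
  toℚᵘ (fromℚᵘ p + fromℚᵘ q)              R.∎)
  where import Relation.Binary.Reasoning.Setoid ℚᵘ.≃-setoid as R

fromℚᵘ-homo-* : ∀ p q → fromℚᵘ (p ℚᵘ.* q) ≡ fromℚᵘ p * fromℚᵘ q
fromℚᵘ-homo-* p q = toℚᵘ-injective (R.begin
  toℚᵘ (fromℚᵘ (p ℚᵘ.* q))                R.≈⟨ toℚᵘ-fromℚᵘ (p ℚᵘ.* q) ⟩
  p ℚᵘ.* q                                R.≈⟨ ℚᵘ.*-cong (toℚᵘ-fromℚᵘ p) (toℚᵘ-fromℚᵘ q) ⟨
  toℚᵘ (fromℚᵘ p) ℚᵘ.* toℚᵘ (fromℚᵘ q)    R.≈⟨ toℚᵘ-homo-* (fromℚᵘ p) (fromℚᵘ q) ⟨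
  toℚᵘ (fromℚᵘ p * fromℚᵘ q)              R.∎)
  where import Relation.Binary.Reasoning.Setoid ℚᵘ.≃-setoid as R

nat-+ : ∀ m n → nat (m ℕ.+ n) ≡ nat m + nat n
nat-+ m n = trans
  (fromℚᵘ-cong {mkℚᵘ (+ (m ℕ.+ n)) 0} {mkℚᵘ (+ m) 0 ℚᵘ.+ mkℚᵘ (+ n) 0}
    (*≡* (cong (ℤ._* (+ 1)) (sym (cong₂ ℤ._+_ (ℤ.*-identityʳ (+ m)) (ℤ.*-identityʳ (+ n)))))))
  (fromℚᵘ-homo-+ (mkℚᵘ (+ m) 0) (mkℚᵘ (+ n) 0))

nat-* : ∀ m n → nat (m ℕ.* n) ≡ nat m * nat n
nat-* m n = trans
  (fromℚᵘ-cong {mkℚᵘ (+ (m ℕ.* n)) 0} {mkℚᵘ (+ m) 0 ℚᵘ.* mkℚᵘ (+ n) 0}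
    (*≡* (cong (ℤ._* (+ 1)) (ℤ.pos-* m n))))
  (fromℚᵘ-homo-* (mkℚᵘ (+ m) 0) (mkℚᵘ (+ n) 0))

nat-inverse : ∀ n .{{_ : ℕ.NonZero n}} → nat n * (+ 1 / n) ≡ 1ℚ
nat-inverse (suc n) = trans
  (sym (fromℚᵘ-homo-* (mkℚᵘ (+ suc n) 0) (mkℚᵘ (+ 1) n)))
  (fromℚᵘ-cong {mkℚᵘ (+ suc n) 0 ℚᵘ.* mkℚᵘ (+ 1) n} {mkℚᵘ (+ 1) 0}
    (*≡* (cong +_ (begin
      suc n ℕ.* 1 ℕ.* 1     ≡⟨ ℕ.*-identityʳ (suc n ℕ.* 1) ⟩
      suc n ℕ.* 1           ≡⟨ ℕ.*-comm (suc n) 1 ⟩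
      1 ℕ.* suc n           ≡⟨ cong (1 ℕ.*_) (sym (ℕ.*-identityˡ (suc n))) ⟩
      1 ℕ.* (1 ℕ.* suc n)   ∎))))

open AbelianGroupProperties (CommutativeRing.+-abelianGroup +-*-commutativeRing)
  using (⁻¹-involutive; inverseˡ-unique)
open CommutativeSemigroupProperties ℕ.*-commutativeSemigroup using (x∙yz≈y∙xz)
open Mult (CommutativeRing.+-monoid +-*-commutativeRing) using (_×_)

×≡nat* : ∀ n x → n × x ≡ nat n * x
×≡nat* zero    x = sym (*-zeroˡ x)
×≡nat* (suc n) x = begin
  x + n × x             ≡⟨ cong₂ _+_ (sym (*-identityˡ x)) (×≡nat* n x) ⟩
  1ℚ * x + nat n * x    ≡⟨ *-distribʳ-+ x 1ℚ (nat n) ⟨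
  (nat 1 + nat n) * x   ≡⟨ cong (_* x) (nat-+ 1 n) ⟨
  nat (suc n) * x       ∎

nat-suc-cancel : ∀ n {x y} → nat (suc n) * x ≡ nat (suc n) * y → x ≡ y
nat-suc-cancel n = cancel-invertible +-*-commutativeRing {nat (suc n)} {+ 1 / suc n} (nat-inverse (suc n))

sumTo-cong : ∀ n {f g} → (∀ k → k < n → f k ≡ g k) → sumTo n f ≡ sumTo n g
sumTo-cong zero    eq = refl
sumTo-cong (suc n) eq = cong₂ _+_ (sumTo-cong n (λ k k<n → eq k (ℕ.m<n⇒m<1+n k<n))) (eq n ℕ.≤-refl)

sumTo-+ : ∀ n f g → sumTo n (λ k → f k + g k) ≡ sumTo n f + sumTo n g
sumTo-+ zero    f g = refl
sumTo-+ (suc n) f g = trans (cong (_+ (f n + g n)) (sumTo-+ n f g))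
  (CommutativeSemigroupProperties.interchange
    (CommutativeRing.+-commutativeSemigroup +-*-commutativeRing) (sumTo n f) (sumTo n g) (f n) (g n))

sumTo-head : ∀ n f → sumTo (suc n) f ≡ f 0 + sumTo n (λ k → f (suc k))
sumTo-head zero    f = +-comm 0ℚ (f 0)
sumTo-head (suc n) f = trans (cong (_+ f (suc n)) (sumTo-head n f)) (+-assoc (f 0) _ (f (suc n)))

open HurwitzSeries +-*-commutativeRing

nC0≡1 : ∀ n → n C 0 ≡ 1
nC0≡1 n = trans (nCk≡nC[n∸k] {0} {n} ℕ.z≤n) (nCn≡1 n)

-- The two halves of the Leibniz rule are the two summands of Pascal's rule, once the second sum is
-- shifted by one index.
⊛-binomial : ∀ n f g → (f ⊛ g) n ≡ sumTo (suc n) (λ k → nat (n C k) * (f k * g (n ∸ k)))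
⊛-binomial zero    f g = sym (trans (+-identityˡ _) (*-identityˡ (f 0 * g 0)))
⊛-binomial (suc n) f g = begin
  (D f ⊛ g) n + (f ⊛ D g) n
    ≡⟨ cong₂ _+_ (⊛-binomial n (D f) g) (⊛-binomial n f (D g)) ⟩
  sumTo (suc n) F₁ + sumTo (suc n) (λ k → nat (n C k) * (f k * g (suc (n ∸ k))))
    -- Truncated subtraction satisfies suc (n ∸ k) = suc n ∸ k only for k ≤ n, hence the use of the
    -- summation bound.
    ≡⟨ cong₂ _+_ (refl {x = sumTo (suc n) F₁}) (sumTo-cong (suc n) (λ { k (s≤s k≤n) →
         cong (λ j → nat (n C k) * (f k * g j)) (sym (ℕ.+-∸-assoc 1 k≤n)) })) ⟩
  sumTo (suc n) F₁ + sumTo (suc n) F₂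
    ≡⟨ cong₂ _+_ (refl {x = sumTo (suc n) F₁}) extend ⟩
  sumTo (suc n) F₁ + (F₂ 0 + sumTo (suc n) (λ k → F₂ (suc k)))
    ≡⟨ +-comm (sumTo (suc n) F₁) _ ⟩
  F₂ 0 + sumTo (suc n) (λ k → F₂ (suc k)) + sumTo (suc n) F₁
    ≡⟨ +-assoc (F₂ 0) _ _ ⟩
  F₂ 0 + (sumTo (suc n) (λ k → F₂ (suc k)) + sumTo (suc n) F₁)
    ≡⟨ cong₂ _+_ (cong (λ c → nat c * (f 0 * g (suc n))) (trans (nC0≡1 n) (sym (nC0≡1 (suc n)))))
         (trans (+-comm (sumTo (suc n) (λ k → F₂ (suc k))) _) (sym (sumTo-+ (suc n) F₁ (λ k → F₂ (suc k))))) ⟩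
  F 0 + sumTo (suc n) (λ k → F₁ k + F₂ (suc k))
    ≡⟨ cong₂ _+_ (refl {x = F 0}) (sumTo-cong (suc n) (λ k _ → pascal k)) ⟩
  F 0 + sumTo (suc n) (λ k → F (suc k))
    ≡⟨ sumTo-head (suc n) F ⟨
  sumTo (suc (suc n)) F ∎
  where
  F F₁ F₂ : ℕ → ℚ
  F  k = nat (suc n C k) * (f k * g (suc n ∸ k))
  F₁ k = nat (n C k) * (f (suc k) * g (n ∸ k))
  F₂ k = nat (n C k) * (f k * g (suc n ∸ k))

  -- The term at k = n + 1 may be appended because its binomial coefficient is 0; splitting off the
  -- head then leaves a shifted sum of the same length as that of `F₁`.
  extend : sumTo (suc n) F₂ ≡ F₂ 0 + sumTo (suc n) (λ k → F₂ (suc k))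
  extend = begin
    sumTo (suc n) F₂              ≡⟨ +-identityʳ _ ⟨
    sumTo (suc n) F₂ + 0ℚ         ≡⟨ cong₂ _+_ (refl {x = sumTo (suc n) F₂})
                                       (trans (cong (λ c → nat c * x) (k>n⇒nCk≡0 {n} {suc n} ℕ.≤-refl)) (*-zeroˡ x)) ⟨
    sumTo (suc (suc n)) F₂        ≡⟨ sumTo-head (suc n) F₂ ⟩
    F₂ 0 + sumTo (suc n) (λ k → F₂ (suc k)) ∎
    where x = f (suc n) * g (suc n ∸ suc n)

  pascal : ∀ k → F₁ k + F₂ (suc k) ≡ F (suc k)
  pascal k = begin
    nat (n C k) * x + nat (n C suc k) * x    ≡⟨ *-distribʳ-+ x (nat (n C k)) (nat (n C suc k)) ⟨
    (nat (n C k) + nat (n C suc k)) * x      ≡⟨ cong (_* x) (nat-+ (n C k) (n C suc k)) ⟨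
    nat (n C k ℕ.+ n C suc k) * x            ≡⟨ cong (λ c → nat c * x) (nCk+nC[k+1]≡[n+1]C[k+1] n k) ⟩
    nat (suc n C suc k) * x                  ∎
    where x = f (suc k) * g (n ∸ k)

-- The recurrence of the Bernoulli numbers

nil : List ℚ
nil = []

-- The list behind B and the functions on it are private, hence not nameable.  They are
-- recovered as solutions of metavariables: with-abstraction turns their arguments inside
-- the normal form of B into variables, so that the unification problem set by refl is a
-- pattern.  Abstracting 1/(m+2) first keeps the abstraction of suc m well typed.
mutual
  entry : List ℚ → ℕ → ℚ
  entry = _

  entry-solution : ∀ m → B (suc m) ≡ B (suc m)
  entry-solution m with + 1 / suc (suc m)
  entry-solution m       | c with suc m
  entry-solution zero    | c | j with nil
  entry-solution zero    | c | suc (suc k) | xs = refl {x = entry xs k}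
  entry-solution zero    | c | j           | xs = refl
  entry-solution (suc m) | c | j = refl

mutual
  bernoullis : ℕ → List ℚ
  bernoullis = _

  bernoullis-solution : ∀ m → B m ≡ B m
  bernoullis-solution m with entry
  ... | e = refl {x = e (bernoullis m) m}

-- `snoc-solution` abstracts this value inside the normal form of `bernoullis (suc m)`, so it must
-- agree definitionally with what is appended there.
next : ℕ → List ℚ → ℚ
next m xs = - ((+ 1 / suc m) * sumTo m (λ k → nat (suc m C k) * entry xs k))

mutual
  snoc : ℕ → List ℚ → ℚ → List ℚ
  snoc = _

  snoc-solution : ∀ m → bernoullis (suc m) ≡ bernoullis (suc m)
  snoc-solution m with next (suc m) (bernoullis m)
  ... | y with bernoullis m
  ...   | xs = refl {x = snoc m xs y}

length-snoc : ∀ m xs y → length (snoc m xs y) ≡ suc (length xs)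
length-snoc m []       y = refl
length-snoc m (x ∷ xs) y = cong suc (length-snoc m xs y)

length-bernoullis : ∀ m → length (bernoullis m) ≡ suc m
length-bernoullis zero    = refl
length-bernoullis (suc m) = trans (length-snoc m (bernoullis m) _) (cong suc (length-bernoullis m))

entry-snoc-init : ∀ m xs y k → k < length xs → entry (snoc m xs y) k ≡ entry xs k
entry-snoc-init m (x ∷ xs) y zero    _         = refl
entry-snoc-init m (x ∷ xs) y (suc k) (s≤s k<n) = entry-snoc-init m xs y k k<n

entry-snoc-last : ∀ m xs y → entry (snoc m xs y) (length xs) ≡ y
entry-snoc-last m []       y = refl
entry-snoc-last m (x ∷ xs) y = entry-snoc-last m xs y

-- `B k` is read from the list built for k. Longer lists only append, so earlier entries persist.
entry-bernoullis : ∀ m k → k ≤ m → entry (bernoullis m) k ≡ B k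
entry-bernoullis zero    zero _   = refl
entry-bernoullis (suc m) k    k≤m with ℕ.m≤n⇒m<n∨m≡n k≤m
... | inj₁ (s≤s k≤m′) = trans
  (entry-snoc-init m (bernoullis m) _ k (subst (k <_) (sym (length-bernoullis m)) (s≤s k≤m′)))
  (entry-bernoullis m k k≤m′)
... | inj₂ refl       = refl

B-suc : ∀ m → B (suc m) ≡ - ((+ 1 / suc (suc m)) * sumTo (suc m) (λ k → nat (suc (suc m) C k) * B k))
B-suc m = begin
  entry (bernoullis (suc m)) (suc m)
    -- The index becomes the length of the old list, which is where the appended value sits.
    ≡⟨ cong (entry (bernoullis (suc m))) (length-bernoullis m) ⟨
  entry (snoc m (bernoullis m) (next (suc m) (bernoullis m))) (length (bernoullis m))
    ≡⟨ entry-snoc-last m (bernoullis m) _ ⟩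
  next (suc m) (bernoullis m)
    ≡⟨ cong (λ x → - ((+ 1 / suc (suc m)) * x)) (sumTo-cong (suc m) (λ { k (s≤s k≤m) →
         cong (nat (suc (suc m) C k) *_) (entry-bernoullis m k k≤m) })) ⟩
  - ((+ 1 / suc (suc m)) * sumTo (suc m) (λ k → nat (suc (suc m) C k) * B k)) ∎

[1+n]Cn≡1+n : ∀ n → suc n C n ≡ suc n
[1+n]Cn≡1+n n = begin
  suc n C n             ≡⟨ nCk≡nC[n∸k] (ℕ.n≤1+n n) ⟩
  suc n C (suc n ∸ n)   ≡⟨ cong (suc n C_) (ℕ.m+n∸n≡m 1 n) ⟩
  suc n C 1             ≡⟨ nC1≡n (suc n) ⟩
  suc n                 ∎

B-recurrence : ∀ m → sumTo (suc (suc m)) (λ k → nat (suc (suc m) C k) * B k) ≡ 0ℚ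
B-recurrence m = begin
  Σ + nat (suc (suc m) C suc m) * B (suc m)
    ≡⟨ cong (λ c → Σ + nat c * B (suc m)) ([1+n]Cn≡1+n (suc m)) ⟩
  Σ + n * B (suc m)
    ≡⟨ cong (λ b → Σ + n * b) (B-suc m) ⟩
  Σ + n * - (n⁻¹ * Σ)
    ≡⟨ cong (λ x → Σ + x) (neg-distribʳ-* n (n⁻¹ * Σ)) ⟨
  Σ - n * (n⁻¹ * Σ)
    ≡⟨ cong (λ x → Σ - x) (trans (sym (*-assoc n n⁻¹ Σ))
         (trans (cong (_* Σ) (nat-inverse (suc (suc m)))) (*-identityˡ Σ))) ⟩
  Σ - Σ
    ≡⟨ +-inverseʳ Σ ⟩
  0ℚ ∎
  where
  n n⁻¹ Σ : ℚ
  n   = nat (suc (suc m))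
  n⁻¹ = + 1 / suc (suc m)
  Σ   = sumTo (suc m) (λ k → nat (suc (suc m) C k) * B k)

-- The exponential series of Bernoulli numbers

-- The series (e^z - 1)/z.
inverses : Series
inverses n = + 1 / suc n

-- The series w(z) = (f(z) - 1)/z; up to the sign (-1)^n its coefficients are the values ζ₁(-n).
B⁺ : Series
B⁺ n = B (suc n) * (+ 1 / suc n)

var-⊛-nat : ∀ g n → (var ⊛ g) (suc n) ≡ nat (suc n) * g n
var-⊛-nat g n = trans (var-⊛ g n) (×≡nat* (suc n) (g n))

var⊛inverses : (var ⊛ inverses) ⊕ const 1ℚ ≋ (λ _ → 1ℚ)
var⊛inverses zero    = refl
var⊛inverses (suc n) = trans (+-identityʳ _) (trans (var-⊛-nat inverses n) (nat-inverse (suc n)))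

var⊛B⁺ : (var ⊛ B⁺) ⊕ const 1ℚ ≋ B
var⊛B⁺ zero    = refl
var⊛B⁺ (suc n) = begin
  (var ⊛ B⁺) (suc n) + 0ℚ                         ≡⟨ +-identityʳ _ ⟩
  (var ⊛ B⁺) (suc n)                              ≡⟨ var-⊛-nat B⁺ n ⟩
  nat (suc n) * (B (suc n) * (+ 1 / suc n))       ≡⟨ cong (nat (suc n) *_) (*-comm (B (suc n)) _) ⟩
  nat (suc n) * ((+ 1 / suc n) * B (suc n))       ≡⟨ *-assoc (nat (suc n)) _ _ ⟨
  nat (suc n) * (+ 1 / suc n) * B (suc n)         ≡⟨ cong (_* B (suc n)) (nat-inverse (suc n)) ⟩
  1ℚ * B (suc n)                                  ≡⟨ *-identityˡ (B (suc n)) ⟩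
  B (suc n)                                       ∎

-- This is f(z) e^z = f(z) + z, the defining equation with denominators cleared; coefficientwise it
-- is the Bernoulli recurrence.
B⊛exp : B ⊛ (λ _ → 1ℚ) ≋ B ⊕ var
B⊛exp n = trans (⊛-binomial n B (λ _ → 1ℚ))
  (trans (sumTo-cong (suc n) (λ k _ → cong (nat (n C k) *_) (*-identityʳ (B k)))) (sums n))
  where
  sums : ∀ n → sumTo (suc n) (λ k → nat (n C k) * B k) ≡ B n + var n
  sums zero          = refl
  -- The recurrence starts at n = 2. At n = 1 the sum is B₀ + B₁, and B₀ = 1 is the coefficient of
  -- z.
  sums (suc zero)    = refl
  sums (suc (suc m)) = begin
    sumTo (suc (suc m)) (λ k → nat (n₂ C k) * B k) + nat (n₂ C n₂) * B n₂
      ≡⟨ cong₂ _+_ (B-recurrence m) (trans (cong (λ c → nat c * B n₂) (nCn≡1 n₂)) (*-identityˡ (B n₂))) ⟩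
    0ℚ + B n₂
      ≡⟨ +-comm 0ℚ (B n₂) ⟩
    B n₂ + 0ℚ ∎
    where n₂ = suc (suc m)

B⊛inverses : B ⊛ inverses ≋ const 1ℚ
B⊛inverses zero    = refl
-- `cofactor` gives the claim multiplied by z. The coefficient at n + 1 therefore appears at n + 2
-- with the nonzero factor n + 2, where z itself has coefficient 0.
B⊛inverses (suc n) = nat-suc-cancel (suc n) (begin
  nat (suc (suc n)) * (B ⊛ inverses) (suc n)   ≡⟨ var-⊛-nat (B ⊛ inverses) (suc n) ⟨
  (var ⊛ (B ⊛ inverses)) (suc (suc n))         ≡⟨ cofactor seriesRing {f = B} {h = inverses} {v = var} {e = λ _ → 1ℚ}
                                                    var⊛inverses B⊛exp (suc (suc n)) ⟩
  0ℚ                                           ≡⟨ *-zeroʳ (nat (suc (suc n))) ⟨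
  nat (suc (suc n)) * 0ℚ                       ∎)

-- Closed form of the defect coefficients

open AdditionFormula +-*-commutativeRing using (module Defect)
open Defect B inverses B⁺ B⊛inverses var⊛inverses var⊛B⁺

defect-edge≡0 : ∀ a → defect (suc a) 0 ≡ 0ℚ
defect-edge≡0 a = nat-suc-cancel (suc a) (begin
  nat (suc (suc a)) * defect (suc a) 0   ≡⟨ ×≡nat* (suc (suc a)) (defect (suc a) 0) ⟨
  suc (suc a) × defect (suc a) 0         ≡⟨ defect-edge a ⟩
  0ℚ                                     ≡⟨ *-zeroʳ (nat (suc (suc a))) ⟨
  nat (suc (suc a)) * 0ℚ                 ∎)

defect-nat-recurrence : ∀ a b →
  nat (suc (suc a)) * defect (suc a) (suc b) + nat (suc b) * defect (suc (suc a)) b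
    ≡ nat (suc b) * const (B (suc (suc a))) b
defect-nat-recurrence a b = begin
  nat (suc (suc a)) * defect (suc a) (suc b) + nat (suc b) * defect (suc (suc a)) b
    ≡⟨ cong₂ _+_ (×≡nat* (suc (suc a)) (defect (suc a) (suc b))) (×≡nat* (suc b) (defect (suc (suc a)) b)) ⟨
  suc (suc a) × defect (suc a) (suc b) + suc b × defect (suc (suc a)) b
    ≡⟨ defect-recurrence a b ⟩
  suc b × const (B (suc (suc a))) b
    ≡⟨ ×≡nat* (suc b) (const (B (suc (suc a))) b) ⟩
  nat (suc b) * const (B (suc (suc a))) b ∎

defect-base : ∀ a → nat (suc (suc a)) * defect (suc a) 1 ≡ B (suc (suc a))
defect-base a = begin
  nat (suc (suc a)) * defect (suc a) 1
    ≡⟨ +-identityʳ _ ⟨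
  nat (suc (suc a)) * defect (suc a) 1 + 0ℚ
    ≡⟨ cong (λ x → nat (suc (suc a)) * defect (suc a) 1 + nat 1 * x) (defect-edge≡0 (suc a)) ⟨
  nat (suc (suc a)) * defect (suc a) 1 + nat 1 * defect (suc (suc a)) 0
    ≡⟨ defect-nat-recurrence a 0 ⟩
  1ℚ * B (suc (suc a))
    ≡⟨ *-identityˡ (B (suc (suc a))) ⟩
  B (suc (suc a)) ∎

defect-step : ∀ a b →
  nat (suc (suc a)) * defect (suc a) (suc (suc b)) ≡ - (nat (suc (suc b)) * defect (suc (suc a)) (suc b))
defect-step a b = inverseˡ-unique _ _
  (trans (defect-nat-recurrence a (suc b)) (*-zeroʳ (nat (suc (suc b)))))

B/! : ℕ → ℚ
B/! n = _/_ (+ 1) (n !) {{n !≢0}} * B n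

nat!-*-B/! : ∀ n → nat (n !) * B/! n ≡ B n
nat!-*-B/! n = begin
  nat (n !) * B/! n                                    ≡⟨ *-assoc (nat (n !)) _ (B n) ⟨
  nat (n !) * (_/_ (+ 1) (n !) {{n !≢0}}) * B n        ≡⟨ cong (_* B n) (nat-inverse (n !) {{n !≢0}}) ⟩
  1ℚ * B n                                             ≡⟨ *-identityˡ (B n) ⟩
  B n                                                  ∎

-- Induction on b for all a: `defect-step` lowers b and raises a, so a + b and with it the Bernoulli
-- index stay fixed. Each step contributes a sign and the ratio (b + 2)/(a + 2), which matches the
-- change in the factorials.
defect-closed : ∀ a b →
  defect (suc a) (suc b) ≡ sign b * (nat (suc a ! ℕ.* suc b !) * B/! (a ℕ.+ b ℕ.+ 2))
defect-closed a zero = nat-suc-cancel (suc a) (begin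
  n * defect (suc a) 1
    ≡⟨ defect-base a ⟩
  B (suc (suc a))
    ≡⟨ nat!-*-B/! (suc (suc a)) ⟨
  nat (suc (suc a) !) * B/! (suc (suc a))
    ≡⟨ cong₂ _*_ (trans (nat-* (suc (suc a)) (suc a !)) (cong (λ k → n * nat k) (sym (ℕ.*-identityʳ (suc a !)))))
         (cong B/! (trans (ℕ.+-comm 2 a) (cong (ℕ._+ 2) (sym (ℕ.+-identityʳ a))))) ⟩
  n * nat (suc a ! ℕ.* 1) * B/! (a ℕ.+ 0 ℕ.+ 2)
    ≡⟨ *-assoc n _ _ ⟩
  n * (nat (suc a ! ℕ.* 1) * B/! (a ℕ.+ 0 ℕ.+ 2))
    ≡⟨ cong (n *_) (*-identityˡ _) ⟨
  n * (1ℚ * (nat (suc a ! ℕ.* 1) * B/! (a ℕ.+ 0 ℕ.+ 2))) ∎)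
  where n = nat (suc (suc a))
defect-closed a (suc b) = nat-suc-cancel (suc a) (begin
  n * defect (suc a) (suc (suc b))
    ≡⟨ defect-step a b ⟩
  - (m * defect (suc (suc a)) (suc b))
    ≡⟨ cong (λ x → - (m * x)) (defect-closed (suc a) b) ⟩
  - (m * (sign b * (nat (suc (suc a) ! ℕ.* suc b !) * B/! (suc a ℕ.+ b ℕ.+ 2))))
    ≡⟨ cong₂ (λ x k → - (m * (sign b * (x * B/! (k ℕ.+ 2)))))
         (trans (cong nat (ℕ.*-assoc (suc (suc a)) (suc a !) (suc b !))) (nat-* (suc (suc a)) p))
         (sym (ℕ.+-suc a b)) ⟩
  - (m * (sign b * (n * nat p * y)))
    ≡⟨ -‿step +-*-commutativeRing m n (sign b) (nat p) y ⟩
  n * (- sign b * (m * nat p * y))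
    ≡⟨ cong (λ x → n * (- sign b * (x * y))) (trans (sym (nat-* (suc (suc b)) p)) (cong nat
         (x∙yz≈y∙xz (suc (suc b)) (suc a !) (suc b !)))) ⟩
  n * (- sign b * (nat (suc a ! ℕ.* suc (suc b) !) * y)) ∎)
  where
  n = nat (suc (suc a))
  m = nat (suc (suc b))
  p = suc a ! ℕ.* suc b !
  y = B/! (a ℕ.+ suc b ℕ.+ 2)

defect-normalised : ∀ a b →
  (+ 1 / suc a) * (+ 1 / suc b) * defect (suc a) (suc b)
    ≡ sign b * (nat (a ! ℕ.* b !) * B/! (a ℕ.+ b ℕ.+ 2))
defect-normalised a b = begin
  (+ 1 / suc a) * (+ 1 / suc b) * defect (suc a) (suc b)
    ≡⟨ cong ((+ 1 / suc a) * (+ 1 / suc b) *_) (trans (defect-closed a b)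
         (cong (λ x → sign b * (x * y)) factor)) ⟩
  (+ 1 / suc a) * (+ 1 / suc b) * (sign b * (nat (suc a) * nat (suc b) * nat (a ! ℕ.* b !) * y))
    ≡⟨ cancel-inverses +-*-commutativeRing {nat (suc a)} {+ 1 / suc a} {nat (suc b)} {+ 1 / suc b}
         (sign b) (nat (a ! ℕ.* b !)) y (nat-inverse (suc a)) (nat-inverse (suc b)) ⟩
  sign b * (nat (a ! ℕ.* b !) * y) ∎
  where
  y = B/! (a ℕ.+ b ℕ.+ 2)

  factor : nat (suc a ! ℕ.* suc b !) ≡ nat (suc a) * nat (suc b) * nat (a ! ℕ.* b !)
  factor = begin
    nat (suc a ℕ.* a ! ℕ.* (suc b ℕ.* b !))     ≡⟨ cong nat (ℕ.[m*n]*[o*p]≡[m*o]*[n*p] (suc a) (a !) (suc b) (b !)) ⟩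
    nat (suc a ℕ.* suc b ℕ.* (a ! ℕ.* b !))     ≡⟨ nat-* (suc a ℕ.* suc b) (a ! ℕ.* b !) ⟩
    nat (suc a ℕ.* suc b) * nat (a ! ℕ.* b !)   ≡⟨ cong (_* nat (a ! ℕ.* b !)) (nat-* (suc a) (suc b)) ⟩
    nat (suc a) * nat (suc b) * nat (a ! ℕ.* b !) ∎

-- Signs and the stuffle relation

sign-+ : ∀ m n → sign (m ℕ.+ n) ≡ sign m * sign n
sign-+ zero    n = sym (*-identityˡ (sign n))
sign-+ (suc m) n = trans (cong -_ (sign-+ m n)) (neg-distribˡ-* (sign m) (sign n))

sign-square : ∀ n → sign n * sign n ≡ 1ℚ
sign-square zero    = refl
sign-square (suc n) = begin
  - sign n * - sign n       ≡⟨ neg-distribˡ-* (sign n) (- sign n) ⟨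
  - (sign n * - sign n)     ≡⟨ cong -_ (neg-distribʳ-* (sign n) (sign n)) ⟨
  - - (sign n * sign n)     ≡⟨ ⁻¹-involutive _ ⟩
  sign n * sign n           ≡⟨ sign-square n ⟩
  1ℚ                        ∎

-- The sum in the closed form is the binomial expansion of a coefficient of w, differentiated m
-- times, times f.
ζ₂-⊛ : ∀ m n → ζ₂ m n ≡ sign m * sign n * ((+ 1 / suc n) * ((λ k → B⁺ (m ℕ.+ k)) ⊛ B) (suc n))
ζ₂-⊛ m n = cong₂ (λ σ x → σ * ((+ 1 / suc n) * x)) (sign-+ m n)
  (sym (⊛-binomial (suc n) (λ k → B⁺ (m ℕ.+ k)) B))

-- This is `defect-coefficient` divided by (m + 1)(n + 1): the three correction terms become ζ₁ and
-- the two ζ₂ values without their signs, and the right side becomes the product of ζ₁ values.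
stuffle-defect : ∀ m n →
  sign n * (nat (m ! ℕ.* n !) * B/! (m ℕ.+ n ℕ.+ 2))
    + (B⁺ (m ℕ.+ n)
      + (+ 1 / suc m) * ((λ k → B⁺ (n ℕ.+ k)) ⊛ B) (suc m)
      + (+ 1 / suc n) * ((λ k → B⁺ (m ℕ.+ k)) ⊛ B) (suc n))
  ≡ B⁺ m * B⁺ n
stuffle-defect m n = begin
  sign n * (nat (m ! ℕ.* n !) * B/! (m ℕ.+ n ℕ.+ 2)) + rest
    ≡⟨ cong (λ x → x + rest) (defect-normalised m n) ⟨
  (+ 1 / suc m) * (+ 1 / suc n) * defect (suc m) (suc n) + rest
    ≡⟨ divide-through +-*-commutativeRing {nat (suc m)} {+ 1 / suc m} {nat (suc n)} {+ 1 / suc n}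
         {defect (suc m) (suc n)} {B⁺ (m ℕ.+ n)} {S₂} {S₁} {B (suc m)} {B (suc n)}
         (nat-inverse (suc m)) (nat-inverse (suc n)) coefficient ⟩
  B⁺ m * B⁺ n ∎
  where
  S₁ = ((λ k → B⁺ (m ℕ.+ k)) ⊛ B) (suc n)
  S₂ = ((λ k → B⁺ (n ℕ.+ k)) ⊛ B) (suc m)
  rest = B⁺ (m ℕ.+ n) + (+ 1 / suc m) * S₂ + (+ 1 / suc n) * S₁

  coefficient : defect (suc m) (suc n)
      + (nat (suc m) * (nat (suc n) * B⁺ (m ℕ.+ n)) + nat (suc n) * S₂ + nat (suc m) * S₁)
    ≡ B (suc m) * B (suc n)
  coefficient = begin
    _ ≡⟨ cong (λ x → defect (suc m) (suc n) + x) (cong₂ _+_ (cong₂ _+_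
           (trans (×≡nat* (suc m) _) (cong (nat (suc m) *_) (×≡nat* (suc n) (B⁺ (m ℕ.+ n)))))
           (trans (×≡nat* (suc n) _) (cong (nat (suc n) *_)
             -- The convolution in s runs over the first index of w(s + t), so the shift by n stands
             -- on the other side there.
             (⊛-cong (λ k → cong B⁺ (ℕ.+-comm k n)) (λ k → refl {x = B k}) (suc m)))))
           (×≡nat* (suc m) S₁)) ⟨
    _ ≡⟨ defect-coefficient m n ⟩
    B (suc m) * B (suc n) ∎

theorem7 : (n₁ n₂ : ℕ) →
    ζ₂ n₁ n₂ + ζ₂ n₂ n₁ + ζ₁ (n₁ ℕ.+ n₂) - ζ₁ n₁ * ζ₁ n₂
    ≡ sign (suc n₁) * (nat (n₁ ! ℕ.* n₂ !) * ((_/_ (+ 1) ((n₁ ℕ.+ n₂ ℕ.+ 2) !) {{(n₁ ℕ.+ n₂ ℕ.+ 2) !≢0}}) * B (n₁ ℕ.+ n₂ ℕ.+ 2)))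
theorem7 n₁ n₂ = begin
  ζ₂ n₁ n₂ + ζ₂ n₂ n₁ + ζ₁ (n₁ ℕ.+ n₂) - ζ₁ n₁ * ζ₁ n₂
    ≡⟨ cong (λ x → x - ζ₁ n₁ * ζ₁ n₂) (cong₂ _+_ (cong₂ _+_
         (ζ₂-⊛ n₁ n₂)
         (trans (ζ₂-⊛ n₂ n₁) (cong (_* U₂) (*-comm (sign n₂) (sign n₁)))))
         (cong (_* B⁺ (n₁ ℕ.+ n₂)) (sign-+ n₁ n₂))) ⟩
  sign n₁ * sign n₂ * U₁ + sign n₁ * sign n₂ * U₂ + sign n₁ * sign n₂ * B⁺ (n₁ ℕ.+ n₂)
    - sign n₁ * B⁺ n₁ * (sign n₂ * B⁺ n₂)
    -- All terms now carry (-1)^(n₁ + n₂). In the defect term (-1)^n₂ occurs twice and cancels;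
    -- moving it across leaves -(-1)^n₁, which is `sign (suc n₁)`.
    ≡⟨ signed-defect +-*-commutativeRing {sign n₁} {sign n₂}
         {nat (n₁ ! ℕ.* n₂ !) * B/! (n₁ ℕ.+ n₂ ℕ.+ 2)} {U₁} {U₂} {B⁺ (n₁ ℕ.+ n₂)} {B⁺ n₁} {B⁺ n₂}
         (sign-square n₂) (stuffle-defect n₁ n₂) ⟩
  sign (suc n₁) * (nat (n₁ ! ℕ.* n₂ !) * B/! (n₁ ℕ.+ n₂ ℕ.+ 2)) ∎
  where
  U₁ = (+ 1 / suc n₂) * ((λ k → B⁺ (n₁ ℕ.+ k)) ⊛ B) (suc n₂)
  U₂ = (+ 1 / suc n₁) * ((λ k → B⁺ (n₂ ℕ.+ k)) ⊛ B) (suc n₁)
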